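{- For every graph $G$ on $n$ vertices, $\operatorname{box}(G)\le MVC(G)+2=n-\alpha(G)+2$.
   Context: $MVC(G)$ is the minimum cardinality of a vertex cover of $G$ (a set of vertices meeting every edge) and $\alpha(G)$ is the maximum size of an independent set. The boxicity $\operatorname{box}(G)$ is the minimum $b$ such that $G$ is the intersection graph of axis-parallel boxes in $\mathbb{R}^b$ (products of $b$ closed intervals), one box per vertex. -}

module Defs where

open import Data.Fin using (Fin)
open import Data.Fin.Subset using (Subset; _∈_; ∣_∣)
open import Data.Nat using (ℕ; _≤_)
open import Data.Product using (_×_; ∃; ∃-syntax; Σ-syntax)
open import Data.Rational using (ℚ; _<_)
open import Data.Sum using (_⊎_)
open import Function.Bundles using (_⇔_)
open import Level using (0ℓ)
open import Relation.Binary.Core using (Rel)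
open import Relation.Binary.Definitions using (Decidable; Irreflexive; Symmetric)
open import Relation.Binary.PropositionalEquality using (_≡_; _≢_)
open import Relation.Nullary using (¬_)

-- Two-sided Dedekind cuts of ℚ.
record ℝ : Set₁ where
  field
    L U       : ℚ → Set
    L-inhab   : ∃ L
    U-inhab   : ∃ U
    L-lower   : ∀ {p q} → p < q → L q → L p
    U-upper   : ∀ {p q} → p < q → U p → U q
    L-rounded : ∀ {p} → L p → ∃[ q ] (p < q × L q)
    U-rounded : ∀ {q} → U q → ∃[ p ] (p < q × U p)
    disjoint  : ∀ {q} → ¬ (L q × U q)
    located   : ∀ {p q} → p < q → L p ⊎ U q

infix 4 _≤ℝ_

_≤ℝ_ : Rel ℝ 0ℓ
x ≤ℝ y = ∀ q → ℝ.L x q → ℝ.L y q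

record ClosedInterval : Set₁ where
  field
    lower upper : ℝ
    lower≤upper : lower ≤ℝ upper

Box : ℕ → Set₁
Box b = Fin b → ClosedInterval

infix 4 _∈ᴮ_

_∈ᴮ_ : ∀ {b} → (Fin b → ℝ) → Box b → Set
x ∈ᴮ B = ∀ i → (ClosedInterval.lower (B i) ≤ℝ x i) × (x i ≤ℝ ClosedInterval.upper (B i))

Intersect : ∀ {b} → Box b → Box b → Set₁
Intersect {b} B C = Σ[ x ∈ (Fin b → ℝ) ] (x ∈ᴮ B × x ∈ᴮ C)

record Graph (n : ℕ) : Set₁ where
  field
    Adj        : Rel (Fin n) 0ℓ
    adj?       : Decidable Adj
    adj-sym    : Symmetric Adj
    adj-irrefl : Irreflexive _≡_ Adj

IsMinimum : ∀ {ℓ} → (ℕ → Set ℓ) → ℕ → Set ℓ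
IsMinimum P m = P m × (∀ k → P k → m ≤ k)

IsMaximum : ∀ {ℓ} → (ℕ → Set ℓ) → ℕ → Set ℓ
IsMaximum P m = P m × (∀ k → P k → k ≤ m)

module _ {n : ℕ} (G : Graph n) where
  open Graph G

  IsVertexCover : Subset n → Set
  IsVertexCover S = ∀ u v → Adj u v → u ∈ S ⊎ v ∈ S

  IsIndependent : Subset n → Set
  IsIndependent S = ∀ u v → u ∈ S → v ∈ S → ¬ Adj u v

  IsMVC : ℕ → Set
  IsMVC = IsMinimum λ k → ∃[ S ] (IsVertexCover S × ∣ S ∣ ≡ k)

  IsIndependenceNumber : ℕ → Set
  IsIndependenceNumber = IsMaximum λ k → ∃[ S ] (IsIndependent S × ∣ S ∣ ≡ k)

  -- The dimension 0 is allowed: ℝ⁰ is a point, so complete graphs have boxicity 0.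
  IsBoxIntersectionGraph : ℕ → Set₁
  IsBoxIntersectionGraph b =
    Σ[ B ∈ (Fin n → Box b) ] (∀ u v → u ≢ v → Adj u v ⇔ Intersect (B u) (B v))

  IsBoxicity : ℕ → Set₁
  IsBoxicity = IsMinimum IsBoxIntersectionGraph

{-# OPTIONS --safe #-}

-- Two boxes are disjoint exactly when in some coordinate one interval lies
-- strictly to the left of the other, and "lies strictly to the left of" is an
-- interval order.  So G has a box representation in dimension k iff its
-- non-edges are covered by the comparability graphs of k interval orders that
-- relate no edge.  The latter can be decided by exhaustive search, so the
-- boxicity can be computed; passing from real boxes to decidable orders costs
-- a double negation, which is harmless as the minimality claim is an
-- inequality of natural numbers.
--
-- For the bound, let S be a minimum vertex cover.  For every c ∈ S take the
-- order placing c to the left of all its non-neighbours, and add one linear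
-- order on the independent set ∁ S.  These |S| + 1 interval orders cover all
-- non-edges.
module Submission where

open import Data.Fin as Fin using (Fin; zero; suc; combine; remQuot)
open import Data.Fin.Properties as Finₚ using (all?; any?; remQuot-combine; ∀-cons)
open import Data.Fin.Subset using (Subset; inside; outside; _∈_; _∉_; ∣_∣; ∁; ⊤)
open import Data.Fin.Subset.Properties using (_∈?_; anySubset?; ∈⊤; ∣⊤∣≡n; ∣p∣≤n; ∣∁p∣≡n∸∣p∣; p⊆q⇒∣p∣≤∣q∣; p⊂q⇒∣p∣<∣q∣; x∈∁p⇒x∉p; x∉p⇒x∈∁p)
open import Data.Integer as ℤ using (+_; -[1+_])
import Data.Integer.Properties as ℤₚ
open import Data.Nat using (ℕ; zero; suc; _+_; _*_; _∸_; _≤_; _<_; z≤n; s≤s)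
import Data.Nat.Coprimality as Coprimality
import Data.Nat.Properties as ℕₚ
open import Data.Product using (Σ-syntax; ∃; _×_; ∃-syntax; _,_; proj₁; proj₂)
open import Data.Rational as ℚ using (ℚ; mkℚ; *<*)
import Data.Rational.Properties as ℚₚ
open import Data.Sum as Sum using (_⊎_; inj₁; inj₂; [_,_]′)
open import Data.Vec using (_∷_; tabulate; here; there)
open import Data.Vec.Properties using (lookup∘tabulate; []=⇒lookup; lookup⇒[]=)
open import Function using (_∘_; id)
open import Function.Bundles using (mk⇔; Equivalence)
open import Level using (0ℓ)
open import Relation.Binary.Core using (Rel)
open import Relation.Binary.Definitions using (Decidable; tri<; tri≈; tri>)
open import Relation.Binary.PropositionalEquality using (_≡_; _≢_; refl; sym; trans; cong; subst; subst₂)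
open import Relation.Nullary using (¬_; Dec; yes; no; does; contradiction)
open import Relation.Nullary.Decidable using (dec-true; decidable-stable; ¬¬-excluded-middle; ¬?; _×-dec_; _⊎-dec_; _→-dec_)
open import Relation.Unary as Unary using (Pred)
open import Defs

private
  variable
    k n : ℕ

-- Finite search

minimum : {P : Pred ℕ 0ℓ} → Unary.Decidable P → ∀ b → P b → ∃ (IsMinimum P)
minimum P? b Pb with P? 0
minimum P? b Pb       | yes P0 = 0 , P0 , λ _ _ → z≤n
minimum P? zero Pb    | no ¬P0 = contradiction Pb ¬P0
minimum {P} P? (suc b) Pb | no ¬P0 with minimum (P? ∘ suc) b Pb
... | m , Pm , m-min = suc m , Pm , least
  where
  least : ∀ k → P k → suc m ≤ k
  least zero    P0 = contradiction P0 ¬P0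
  least (suc k) Pk = s≤s (m-min k Pk)

-- Finitely many double negations commute with `∀`. This allows excluded middle to be assumed at all
-- instances of a finite family at once.
¬¬-finite : ∀ {p} {P : Pred (Fin n) p} → (∀ i → ¬ ¬ P i) → ¬ ¬ (∀ i → P i)
¬¬-finite {zero}          _   ¬∀ = ¬∀ λ ()
¬¬-finite {suc n} {P = P} ¬¬P ¬∀ =
  ¬¬P zero λ P0 → ¬¬-finite (¬¬P ∘ suc) λ Ps → ¬∀ (∀-cons {P = P} P0 Ps)

module _ {P : Pred (Fin n) 0ℓ} (P? : Unary.Decidable P) where

  comprehension : Subset n
  comprehension = tabulate (does ∘ P?)

  ∈-comprehension⁺ : ∀ {i} → P i → i ∈ comprehension
  ∈-comprehension⁺ {i} Pi = lookup⇒[]= i _ (trans (lookup∘tabulate _ i) (dec-true (P? i) Pi))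

  ∈-comprehension⁻ : ∀ {i} → i ∈ comprehension → P i
  ∈-comprehension⁻ {i} i∈ with P? i | trans (sym (lookup∘tabulate (does ∘ P?) i)) ([]=⇒lookup i∈)
  ... | yes Pi | _ = Pi

enumerate : (S : Subset n) → Fin ∣ S ∣ → Fin n
enumerate (outside ∷ S) i       = suc (enumerate S i)
enumerate (inside  ∷ S) zero    = zero
enumerate (inside  ∷ S) (suc i) = suc (enumerate S i)

enumerate-surjective : (S : Subset n) → ∀ {x} → x ∈ S → ∃[ i ] enumerate S i ≡ x
enumerate-surjective (inside  ∷ S) here        = zero , refl
enumerate-surjective (inside  ∷ S) (there x∈S) =
  let i , eq = enumerate-surjective S x∈S in suc i , cong suc eq
enumerate-surjective (outside ∷ S) (there x∈S) =
  let i , eq = enumerate-surjective S x∈S in i , cong suc eq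

-- Dedekind reals

infix 4 _<ℝ_

_<ℝ_ : Rel ℝ 0ℓ
x <ℝ y = ∃[ q ] (ℝ.U x q × ℝ.L y q)

-- Roundedness of `y` leaves a gap `q < r` below `y`, and locatedness of `x` on that gap leaves only
-- `L x q` or a witness of `x <ℝ y`.
≮ℝ⇒≥ℝ : ∀ x y → ¬ (x <ℝ y) → y ≤ℝ x
≮ℝ⇒≥ℝ x y x≮y q yq with ℝ.L-rounded y yq
... | r , q<r , yr with ℝ.located x q<r
...   | inj₁ xq = xq
...   | inj₂ xr = contradiction (r , xr , yr) x≮y

≥ℝ⇒≮ℝ : ∀ x y → y ≤ℝ x → ¬ (x <ℝ y)
≥ℝ⇒≮ℝ x y y≤x (q , xq , yq) = ℝ.disjoint x (y≤x q yq , xq)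

module _ (x y : ℝ) where
  private
    module X = ℝ x
    module Y = ℝ y

  infixl 6 _⊔ℝ_

  -- Which of two cuts is larger cannot be decided, so the maximum is built from the cuts
  -- themselves: lower parts are united, upper parts intersected. Only rational witnesses are ever
  -- compared.
  _⊔ℝ_ : ℝ
  _⊔ℝ_ = record
    { L         = λ q → X.L q ⊎ Y.L q
    ; U         = λ q → X.U q × Y.U q
    ; L-inhab   = let q , xq = X.L-inhab in q , inj₁ xq
    ; U-inhab   = U-inhab
    ; L-lower   = λ p<q → Sum.map (X.L-lower p<q) (Y.L-lower p<q)
    ; U-upper   = λ p<q (xp , yp) → X.U-upper p<q xp , Y.U-upper p<q yp
    ; L-rounded = λ where
        (inj₁ xp) → let q , p<q , xq = X.L-rounded xp in q , p<q , inj₁ xq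
        (inj₂ yp) → let q , p<q , yq = Y.L-rounded yp in q , p<q , inj₂ yq
    ; U-rounded = U-rounded
    ; disjoint  = λ where
        (inj₁ l , u , _) → X.disjoint (l , u)
        (inj₂ l , _ , u) → Y.disjoint (l , u)
    ; located   = located
    }
    where
    U-inhab : ∃[ q ] (X.U q × Y.U q)
    U-inhab with X.U-inhab | Y.U-inhab
    ... | p , xp | q , yq with ℚₚ.<-cmp p q
    ...   | tri< p<q _ _  = q , X.U-upper p<q xp , yq
    ...   | tri≈ _ refl _ = q , xp , yq
    ...   | tri> _ _ q<p  = p , xp , Y.U-upper q<p yq

    U-rounded : ∀ {r} → X.U r × Y.U r → ∃[ q ] (q ℚ.< r × X.U q × Y.U q)
    U-rounded (xr , yr) with X.U-rounded xr | Y.U-rounded yr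
    ... | p , p<r , xp | q , q<r , yq with ℚₚ.<-cmp p q
    ...   | tri< p<q _ _  = q , q<r , X.U-upper p<q xp , yq
    ...   | tri≈ _ refl _ = q , q<r , xp , yq
    ...   | tri> _ _ q<p  = p , p<r , xp , Y.U-upper q<p yq

    located : ∀ {p q} → p ℚ.< q → (X.L p ⊎ Y.L p) ⊎ (X.U q × Y.U q)
    located p<q with X.located p<q | Y.located p<q
    ... | inj₁ xp | _       = inj₁ (inj₁ xp)
    ... | inj₂ _  | inj₁ yp = inj₁ (inj₂ yp)
    ... | inj₂ xq | inj₂ yq = inj₂ (xq , yq)

-- `mkℚ` stores the denominator minus one, so `0` means denominator 1.
ℕ→ℚ : ℕ → ℚ
ℕ→ℚ m = mkℚ (+ m) 0 (Coprimality.sym (Coprimality.1-coprimeTo m))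

ℕ→ℚ-mono-< : ∀ {a b} → a < b → ℕ→ℚ a ℚ.< ℕ→ℚ b
ℕ→ℚ-mono-< {a} {b} a<b = *<* (subst₂ ℤ._<_ (sym (ℤₚ.*-identityʳ (+ a))) (sym (ℤₚ.*-identityʳ (+ b))) (ℤ.+<+ a<b))

ℕ→ℚ-cancel-< : ∀ {a b} → ℕ→ℚ a ℚ.< ℕ→ℚ b → a < b
ℕ→ℚ-cancel-< {a} {b} (*<* a<b) = ℤₚ.drop‿+<+ (subst₂ ℤ._<_ (ℤₚ.*-identityʳ (+ a)) (ℤₚ.*-identityʳ (+ b)) a<b)

ℕ→ℝ : ℕ → ℝ
ℕ→ℝ m = record
  { L         = ℚ._< ℕ→ℚ m
  ; U         = ℕ→ℚ m ℚ.<_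
  ; L-inhab   = ℚ.- ℚ.1ℚ , *<* (subst (-[1+ 0 ] ℤ.<_) (sym (ℤₚ.*-identityʳ (+ m))) ℤ.-<+)
  ; U-inhab   = ℕ→ℚ (suc m) , ℕ→ℚ-mono-< (ℕₚ.n<1+n m)
  ; L-lower   = ℚₚ.<-trans
  ; U-upper   = λ p<q m<p → ℚₚ.<-trans m<p p<q
  ; L-rounded = λ p<m → let q , p<q , q<m = ℚₚ.<-dense p<m in q , p<q , q<m
  ; U-rounded = λ m<q → let p , m<p , p<q = ℚₚ.<-dense m<q in p , p<q , m<p
  ; disjoint  = λ (q<m , m<q) → ℚₚ.<-irrefl refl (ℚₚ.<-trans q<m m<q)
  ; located   = located
  }
  where
  located : ∀ {p q} → p ℚ.< q → p ℚ.< ℕ→ℚ m ⊎ ℕ→ℚ m ℚ.< q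
  located {p} p<q with p ℚₚ.<? ℕ→ℚ m
  ... | yes p<m = inj₁ p<m
  ... | no  p≮m = inj₂ (ℚₚ.≤-<-trans (ℚₚ.≮⇒≥ p≮m) p<q)

ℕ→ℝ-mono-< : ∀ {a b} → a < b → ℕ→ℝ a <ℝ ℕ→ℝ b
ℕ→ℝ-mono-< a<b = ℚₚ.<-dense (ℕ→ℚ-mono-< a<b)

ℕ→ℝ-cancel-< : ∀ {a b} → ℕ→ℝ a <ℝ ℕ→ℝ b → a < b
ℕ→ℝ-cancel-< (_ , a<q , q<b) = ℕ→ℚ-cancel-< (ℚₚ.<-trans a<q q<b)

-- Interval orders

-- The Ferrers, or (2+2)-free, form of an interval order. Transitivity is the case `c = b`, where
-- irreflexivity excludes the second alternative.
IsIntervalOrder : ∀ {a} {A : Set a} → Rel A 0ℓ → Set a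
IsIntervalOrder _≺_ =
  (∀ a → ¬ (a ≺ a)) × (∀ a b c d → a ≺ b → c ≺ d → a ≺ d ⊎ c ≺ b)

infix 4 _≺ᴵ_

_≺ᴵ_ : Rel ClosedInterval 0ℓ
I ≺ᴵ J = ClosedInterval.upper I <ℝ ClosedInterval.lower J

≺ᴵ-isIntervalOrder : IsIntervalOrder _≺ᴵ_
≺ᴵ-isIntervalOrder = (λ I → ≥ℝ⇒≮ℝ (upper I) (lower I) (lower≤upper I)) , ferrers
  where
  open ClosedInterval
  ferrers : ∀ I J K M → I ≺ᴵ J → K ≺ᴵ M → I ≺ᴵ M ⊎ K ≺ᴵ J
  -- The rationals `p` and `q` separate the two pairs; the larger one lies above both upper
  -- endpoints and below the lower endpoint that it came with.
  ferrers I J K M (p , Ip , Jp) (q , Kq , Mq) with ℚₚ.<-cmp p q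
  ... | tri< p<q _ _  = inj₁ (q , ℝ.U-upper (upper I) p<q Ip , Mq)
  ... | tri≈ _ refl _ = inj₁ (p , Ip , Mq)
  ... | tri> _ _ q<p  = inj₂ (p , ℝ.U-upper (upper K) q<p Kq , Jp)

intersect⇒¬≺ᴵ : (B C : Box k) → Intersect B C → ∀ i → ¬ (B i ≺ᴵ C i)
intersect⇒¬≺ᴵ B C (x , x∈B , x∈C) i =
  ≥ℝ⇒≮ℝ (upper (B i)) (lower (C i)) λ q → proj₂ (x∈B i) q ∘ proj₁ (x∈C i) q
  where open ClosedInterval

-- The maximum of the two lower endpoints is a common point.
¬≺ᴵ⇒intersect : (B C : Box k) → (∀ i → ¬ (B i ≺ᴵ C i) × ¬ (C i ≺ᴵ B i)) → Intersect B C
¬≺ᴵ⇒intersect B C ¬≺ =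
    (λ i → lower (B i) ⊔ℝ lower (C i))
  , (λ i → (λ q → inj₁)
         , λ q → [ lower≤upper (B i) q , ≮ℝ⇒≥ℝ (upper (B i)) (lower (C i)) (proj₁ (¬≺ i)) q ]′)
  , (λ i → (λ q → inj₂)
         , λ q → [ ≮ℝ⇒≥ℝ (upper (C i)) (lower (B i)) (proj₂ (¬≺ i)) q , lower≤upper (C i) q ]′)
  where open ClosedInterval

-- The interval of v runs from |{p : p ≺ v}| to |⋃ {p : p ≺ u}|, the union being
-- over all u with v ⊀ u.
module Endpoints {_≺_ : Rel (Fin n) 0ℓ} (_≺?_ : Decidable _≺_) (≺-io : IsIntervalOrder _≺_) where

  below? : ∀ v → Unary.Decidable (_≺ v)
  below? v p = p ≺? v

  belowSome? : ∀ v → Unary.Decidable (λ p → ∃[ u ] (p ≺ u × ¬ (v ≺ u)))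
  belowSome? v p = any? λ u → (p ≺? u) ×-dec ¬? (v ≺? u)

  left right : Fin n → ℕ
  left  v = ∣ comprehension (below? v) ∣
  right v = ∣ comprehension (belowSome? v) ∣

  ⊀⇒left≤right : ∀ {v u} → ¬ (v ≺ u) → left u ≤ right v
  ⊀⇒left≤right {v} {u} v⊀u = p⊆q⇒∣p∣≤∣q∣ λ p∈ →
    ∈-comprehension⁺ (belowSome? v) (u , ∈-comprehension⁻ (below? u) p∈ , v⊀u)

  -- The set counted by `right v` lies inside the one counted by `left u` by the Ferrers condition.
  -- The inclusion is strict because `v` itself is only in the latter.
  ≺⇒right<left : ∀ {v u} → v ≺ u → right v < left u
  ≺⇒right<left {v} {u} v≺u = p⊂q⇒∣p∣<∣q∣
    ( (λ p∈ → ∈-comprehension⁺ (below? u) (below-u (∈-comprehension⁻ (belowSome? v) p∈)))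
    , v , ∈-comprehension⁺ (below? u) v≺u
    , λ v∈ → let _ , v≺w , v⊀w = ∈-comprehension⁻ (belowSome? v) v∈ in v⊀w v≺w)
    where
    below-u : ∀ {p} → ∃[ w ] (p ≺ w × ¬ (v ≺ w)) → p ≺ u
    below-u {p} (w , p≺w , v⊀w) =
      [ id , (λ v≺w → contradiction v≺w v⊀w) ]′ (proj₂ ≺-io p w v u p≺w v≺u)

  interval : Fin n → ClosedInterval
  interval v = record
    { lower       = ℕ→ℝ (left v)
    ; upper       = ℕ→ℝ (right v)
    ; lower≤upper = ≮ℝ⇒≥ℝ (ℕ→ℝ (right v)) (ℕ→ℝ (left v)) λ r<l →
        ℕₚ.<⇒≱ (ℕ→ℝ-cancel-< r<l) (⊀⇒left≤right (proj₁ ≺-io v))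
    }

  ≺⇒≺ᴵ : ∀ {v u} → v ≺ u → interval v ≺ᴵ interval u
  ≺⇒≺ᴵ = ℕ→ℝ-mono-< ∘ ≺⇒right<left

  ≺ᴵ⇒≺ : ∀ {v u} → interval v ≺ᴵ interval u → v ≺ u
  ≺ᴵ⇒≺ {v} {u} v≺ᴵu = decidable-stable (v ≺? u) λ v⊀u →
    ℕₚ.<⇒≱ (ℕ→ℝ-cancel-< v≺ᴵu) (⊀⇒left≤right v⊀u)

-- Families of relations on Fin n, coded as finite sets

-- Relations valued in `Set` cannot be enumerated, but subsets of a finite set can; this turns the
-- search for orders into a call of `anySubset?`.
decode : Subset (k * (n * n)) → Fin k → Rel (Fin n) 0ℓ
decode S i u v = combine i (combine u v) ∈ S

module _ {R : Fin k → Rel (Fin n) 0ℓ} (R? : ∀ i → Decidable (R i)) where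
  private
    Uncurried : Fin k × Fin (n * n) → Set
    Uncurried (i , uv) = let u , v = remQuot n uv in R i u v

    uncurried? : Unary.Decidable (Uncurried ∘ remQuot {k} (n * n))
    uncurried? j = let i , uv = remQuot {k} (n * n) j ; u , v = remQuot {n} n uv in R? i u v

    uncurry-≡ : ∀ i u v → Uncurried (remQuot {k} (n * n) (combine i (combine u v))) ≡ R i u v
    uncurry-≡ i u v = trans
      (cong Uncurried (remQuot-combine {k} {n * n} i (combine u v)))
      (cong (λ (u′ , v′) → R i u′ v′) (remQuot-combine {n} {n} u v))

  encode : Subset (k * (n * n))
  encode = comprehension uncurried?

  decode-encode⁺ : ∀ {i u v} → R i u v → decode {k} {n} encode i u v
  decode-encode⁺ {i} {u} {v} r = ∈-comprehension⁺ uncurried? (subst id (sym (uncurry-≡ i u v)) r)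

  decode-encode⁻ : ∀ {i u v} → decode {k} {n} encode i u v → R i u v
  decode-encode⁻ {i} {u} {v} r = subst id (uncurry-≡ i u v) (∈-comprehension⁻ uncurried? r)

module _ (G : Graph n) where
  open Graph G

-- Boxicity through interval orders

  Represents : (Fin k → Rel (Fin n) 0ℓ) → Set
  Represents R =
      (∀ i → IsIntervalOrder (R i))
    × (∀ u v → Adj u v → ∀ i → ¬ R i u v)
    × (∀ u v → u ≢ v → (∀ i → ¬ R i u v × ¬ R i v u) → Adj u v)

  represents? : {R : Fin k → Rel (Fin n) 0ℓ} → (∀ i → Decidable (R i)) → Dec (Represents R)
  represents? R? =
    (all? λ i →
        (all? λ a → ¬? (R? i a a))
      ×-dec (all? λ a → all? λ b → all? λ c → all? λ d →
        R? i a b →-dec (R? i c d →-dec (R? i a d ⊎-dec R? i c b))))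
    ×-dec (all? λ u → all? λ v → adj? u v →-dec all? λ i → ¬? (R? i u v))
    ×-dec (all? λ u → all? λ v → ¬? (u Finₚ.≟ v) →-dec
      ((all? λ i → ¬? (R? i u v) ×-dec ¬? (R? i v u)) →-dec adj? u v))

  represents-resp : {R R′ : Fin k → Rel (Fin n) 0ℓ} →
    (∀ {i u v} → R i u v → R′ i u v) → (∀ {i u v} → R′ i u v → R i u v) →
    Represents R → Represents R′
  represents-resp f g (io , edge , nonedge) =
      (λ i → (λ a → proj₁ (io i) a ∘ g)
           , λ a b c d ab cd → Sum.map f f (proj₂ (io i) a b c d (g ab) (g cd)))
    , (λ u v uv i → edge u v uv i ∘ g)
    , λ u v u≢v none → nonedge u v u≢v λ i → proj₁ (none i) ∘ f , proj₂ (none i) ∘ f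

  -- A decidable counterpart of `IsBoxIntersectionGraph` that mentions no reals, hence a predicate
  -- to which `minimum` applies.
  HasOrderRepresentation : ℕ → Set
  HasOrderRepresentation k = Σ[ S ∈ Subset (k * (n * n)) ] Represents (decode {k} {n} S)

  hasOrderRepresentation? : Unary.Decidable HasOrderRepresentation
  hasOrderRepresentation? k =
    anySubset? λ S → represents? {k} λ i u v → combine i (combine u v) ∈? S

  represents⇒hasOrderRepresentation : {R : Fin k → Rel (Fin n) 0ℓ} →
    (∀ i → Decidable (R i)) → Represents R → HasOrderRepresentation k
  represents⇒hasOrderRepresentation R? rep =
    encode R? , represents-resp (decode-encode⁺ R?) (decode-encode⁻ R?) rep

  represents⇒boxes : {R : Fin k → Rel (Fin n) 0ℓ} →
    (∀ i → Decidable (R i)) → Represents R → IsBoxIntersectionGraph G k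
  represents⇒boxes {k} R? (io , edge , nonedge) = box , λ u v u≢v → mk⇔
    (λ uv → ¬≺ᴵ⇒intersect (box u) (box v) λ i →
      edge u v uv i ∘ E.≺ᴵ⇒≺ i , edge v u (adj-sym uv) i ∘ E.≺ᴵ⇒≺ i)
    (λ (x , x∈u , x∈v) → nonedge u v u≢v λ i →
        intersect⇒¬≺ᴵ (box u) (box v) (x , x∈u , x∈v) i ∘ E.≺⇒≺ᴵ i
      , intersect⇒¬≺ᴵ (box v) (box u) (x , x∈v , x∈u) i ∘ E.≺⇒≺ᴵ i)
    where
    module E i = Endpoints (R? i) (io i)
    box : Fin n → Box k
    box u i = E.interval i u

  boxes⇒represents : ((B , _) : IsBoxIntersectionGraph G k) →
    Represents {k} (λ i u v → B u i ≺ᴵ B v i)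
  boxes⇒represents (B , B-rep) =
      (λ i → (λ a → proj₁ ≺ᴵ-isIntervalOrder (B a i))
           , λ a b c d → proj₂ ≺ᴵ-isIntervalOrder (B a i) (B b i) (B c i) (B d i))
    , (λ u v uv → intersect⇒¬≺ᴵ (B u) (B v)
        (Equivalence.to (B-rep u v λ u≡v → adj-irrefl u≡v uv) uv))
    , λ u v u≢v none → Equivalence.from (B-rep u v u≢v) (¬≺ᴵ⇒intersect (B u) (B v) none)

  -- `≺ᴵ` between real intervals is not decidable, but only its `k * n * n` instances on the given
  -- boxes matter, and under a double negation these may all be taken as decided.
  boxes⇒¬¬hasOrderRepresentation : IsBoxIntersectionGraph G k → ¬ ¬ HasOrderRepresentation k
  boxes⇒¬¬hasOrderRepresentation boxes ¬rep =
    ¬¬-finite (λ i → ¬¬-finite λ u → ¬¬-finite λ v → ¬¬-excluded-middle) λ R? →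
      ¬rep (represents⇒hasOrderRepresentation R? (boxes⇒represents boxes))

  boxicity : ∀ {b} → HasOrderRepresentation b → ∃[ m ] (IsBoxicity G m × m ≤ b)
  boxicity {b} rep =
    let m , (S , S-rep) , m-min = minimum hasOrderRepresentation? b rep
    in m , ( represents⇒boxes {m} (λ i u v → combine i (combine u v) ∈? S) S-rep
           , λ k boxes → decidable-stable (m ℕₚ.≤? k) λ m≰k →
               boxes⇒¬¬hasOrderRepresentation boxes (m≰k ∘ m-min k))
         , m-min b rep

-- The orders given by a vertex cover

  -- In the orders `suc i`, the condition `v ≢ u` secures irreflexivity, since no vertex is adjacent
  -- to itself.
  coverOrder : (S : Subset n) → Fin (suc ∣ S ∣) → Rel (Fin n) 0ℓ
  coverOrder S zero    u v = u ∉ S × v ∉ S × u Fin.< v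
  coverOrder S (suc i) u v = u ≡ enumerate S i × v ≢ u × ¬ Adj u v

  coverOrder? : ∀ S i → Decidable (coverOrder S i)
  coverOrder? S zero    u v = ¬? (u ∈? S) ×-dec ¬? (v ∈? S) ×-dec (u Finₚ.<? v)
  coverOrder? S (suc i) u v =
    (u Finₚ.≟ enumerate S i) ×-dec ¬? (v Finₚ.≟ u) ×-dec ¬? (adj? u v)

  coverOrder-represents : ∀ {S} → IsVertexCover G S → Represents (coverOrder S)
  coverOrder-represents {S} S-cover = isIntervalOrder , edge , nonedge
    where
    isIntervalOrder : ∀ i → IsIntervalOrder (coverOrder S i)
    isIntervalOrder zero = (λ a (_ , _ , a<a) → Finₚ.<-irrefl refl a<a) , ferrers
      where
      ferrers : ∀ a b c d → coverOrder S zero a b → coverOrder S zero c d →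
                coverOrder S zero a d ⊎ coverOrder S zero c b
      ferrers a b c d (a∉ , b∉ , a<b) (c∉ , d∉ , c<d) with a Finₚ.<? d
      ... | yes a<d = inj₁ (a∉ , d∉ , a<d)
      -- Here `c < d ≤ a < b`.
      ... | no  a≮d = inj₂ (c∉ , b∉ , ℕₚ.<-trans c<d (ℕₚ.≤-<-trans (ℕₚ.≮⇒≥ a≮d) a<b))
    isIntervalOrder (suc i) =
        (λ a (_ , a≢a , _) → a≢a refl)
      -- Only `enumerate S i` has anything to its right, so `a` and `c` coincide and the second
      -- relation already is `a ≺ d`.
      , λ { a b c d (refl , _) (refl , cd) → inj₁ (refl , cd) }

    edge : ∀ u v → Adj u v → ∀ i → ¬ coverOrder S i u v
    edge u v uv zero    (u∉ , v∉ , _) = [ u∉ , v∉ ]′ (S-cover u v uv)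
    edge u v uv (suc i) (_ , _ , ¬uv) = ¬uv uv

    separated : ∀ {u v} → u ∈ S → v ≢ u → ¬ Adj u v → ∃[ i ] coverOrder S i u v
    separated u∈S v≢u ¬uv =
      let i , eq = enumerate-surjective S u∈S in suc i , sym eq , v≢u , ¬uv

    nonedge : ∀ u v → u ≢ v → (∀ i → ¬ coverOrder S i u v × ¬ coverOrder S i v u) → Adj u v
    nonedge u v u≢v none with adj? u v | u ∈? S | v ∈? S
    ... | yes uv | _       | _       = uv
    ... | no ¬uv | yes u∈S | _       =
      let i , r = separated u∈S (u≢v ∘ sym) ¬uv in contradiction r (proj₁ (none i))
    ... | no ¬uv | no _    | yes v∈S =
      let i , r = separated v∈S u≢v (¬uv ∘ adj-sym) in contradiction r (proj₂ (none i))
    ... | no _   | no u∉S  | no v∉S  with Finₚ.<-cmp u v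
    ...   | tri< u<v _ _ = contradiction (u∉S , v∉S , u<v) (proj₁ (none zero))
    ...   | tri≈ _ u≡v _ = contradiction u≡v u≢v
    ...   | tri> _ _ v<u = contradiction (v∉S , u∉S , v<u) (proj₂ (none zero))

-- Vertex covers and independent sets

  minimumVertexCover : ∃ (IsMVC G)
  minimumVertexCover = minimum
    (λ k → anySubset? λ S →
      (all? λ u → all? λ v → adj? u v →-dec (u ∈? S ⊎-dec v ∈? S)) ×-dec (∣ S ∣ ℕₚ.≟ k))
    -- The set of all vertices is a cover of size `n`, which bounds the search.
    n (⊤ , (λ _ _ _ → inj₁ ∈⊤) , ∣⊤∣≡n n)

  ∁-independent : ∀ {S} → IsVertexCover G S → IsIndependent G (∁ S)
  ∁-independent S-cover u v u∈ v∈ uv = [ x∈∁p⇒x∉p u∈ , x∈∁p⇒x∉p v∈ ]′ (S-cover u v uv)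

  ∁-cover : ∀ {T} → IsIndependent G T → IsVertexCover G (∁ T)
  ∁-cover {T} T-indep u v uv with u ∈? T | v ∈? T
  ... | no u∉T  | _       = inj₁ (x∉p⇒x∈∁p u∉T)
  ... | yes _   | no v∉T  = inj₂ (x∉p⇒x∈∁p v∉T)
  ... | yes u∈T | yes v∈T = contradiction uv (T-indep u v u∈T v∈T)

  -- Complementation exchanges vertex covers and independent sets.
  gallai : ∀ {m} → IsMVC G m → IsIndependenceNumber G (n ∸ m)
  gallai {m} ((S , S-cover , refl) , m-min) =
    (∁ S , ∁-independent S-cover , ∣∁p∣≡n∸∣p∣ S) , maximal
    where
    maximal : ∀ k → ∃[ T ] (IsIndependent G T × ∣ T ∣ ≡ k) → k ≤ n ∸ m
    -- As `∁ T` is a cover, `m ≤ n ∸ ∣ T ∣`. Subtracting from `n` reverses this, and `∣ T ∣ ≤ n`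
    -- makes the double truncated subtraction return `∣ T ∣`.
    maximal _ (T , T-indep , refl) = subst (_≤ n ∸ m) (ℕₚ.m∸[m∸n]≡n (∣p∣≤n T))
      (ℕₚ.∸-monoʳ-≤ n (m-min (n ∸ ∣ T ∣) (∁ T , ∁-cover T-indep , ∣∁p∣≡n∸∣p∣ T)))

theorem15 : (n : ℕ) (G : Graph n) →
    ∃[ box ] ∃[ mvc ] ∃[ α ]
    (IsBoxicity G box × IsMVC G mvc × IsIndependenceNumber G α ×
    box ≤ mvc + 2 × mvc + 2 ≡ n ∸ α + 2)
theorem15 n G with minimumVertexCover G
... | m , mvc@((S , S-cover , refl) , _) =
  let b , b-box , b≤1+m = boxicity G
        (represents⇒hasOrderRepresentation G (coverOrder? G S) (coverOrder-represents G S-cover))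
  in b , m , n ∸ m , b-box , mvc , gallai G mvc
   -- The cover orders give dimension `suc m`, which is then weakened to `m + 2`.
   , ℕₚ.≤-trans b≤1+m (ℕₚ.≤-trans (ℕₚ.n≤1+n (suc m)) (ℕₚ.≤-reflexive (ℕₚ.+-comm 2 m)))
   , cong (_+ 2) (sym (ℕₚ.m∸[m∸n]≡n (∣p∣≤n S)))
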